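{- The reduction $\leadsto$ is strongly normalizing: there is no infinite sequence of $\leadsto$ steps.
   Context: Differential proof nets with exponential boxes. A closed box is a box with no auxiliary doors. Rule (e): a dereliction cell (unary $?$) whose principal port is connected to the principal port of a closed box is replaced, together with the box, by the box content. Rule (er): a weakening cell (0-ary $?$) whose principal port is connected to the principal port of a closed box is erased together with the box. $\leadsto$ denotes the application of rule (e) or (er) inside boxes (at depth $\ge1$). -}

module Defs where

open import Data.Nat using (ℕ; suc; _≟_)
open import Data.List using (List; []; _∷_; _++_; map; concatMap; length; filter)
open import Data.List.Membership.Propositional using (_∈_; _∉_)
open import Data.List.Relation.Unary.All using (All)
open import Data.List.Relation.Binary.Permutation.Propositional using (_↭_)
open import Relation.Binary.PropositionalEquality using (_≡_; _≢_)
open import Function.Definitions using (Injective)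

-- Untyped differential proof nets with exponential boxes.
--
-- Wires are represented by names (natural numbers): two ports are
-- connected iff they carry the same name.  Each wire name must occur
-- exactly twice (among the ports of cells and the conclusions).
-- A box is a cell with a principal door, a list of auxiliary doors, and
-- a content which is a *net*, i.e. a finite formal sum (list) of simple
-- nets.  Wire names inside a box content are local to that box (scoping).

data Kind : Set where
  tensor par one bot : Kind
  oc : Kind   -- n-ary ! cell (coweakening, codereliction, cocontraction)
  wn : Kind   -- n-ary ? cell (weakening = 0-ary, dereliction = 1-ary, contraction)

mutual
  data Cell : Set where
    -- gen k p as : a cell of kind k with principal port p and auxiliary ports as
    gen : Kind → ℕ → List ℕ → Cell
    -- box p ws B : a box with principal door p, auxiliary doors ws, content B
    box : ℕ → List ℕ → List SNet → Cell

  record SNet : Set where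
    inductive
    constructor net
    field
      cells : List Cell
      concl : List ℕ

open SNet public

-- a (differential) net: a finite formal sum of simple nets
Net : Set
Net = List SNet

-- names of the ports of a cell (at this level only; box contents are a
-- separate scope)
cellNames : Cell → List ℕ
cellNames (gen k p as) = p ∷ as
cellNames (box p ws B) = p ∷ ws

netNames : SNet → List ℕ
netNames s = concl s ++ concatMap cellNames (cells s)

count : ℕ → List ℕ → ℕ
count x xs = length (filter (x ≟_) xs)

-- renaming of the wires of a cell (not touching the local scope of boxes)
ren : (ℕ → ℕ) → Cell → Cell
ren ρ (gen k p as) = gen k (ρ p) (map ρ as)
ren ρ (box p ws B) = box (ρ p) (map ρ ws) B

mutual
  data WFCell : Cell → Set where
    wf-tensor : ∀ {p a b} → WFCell (gen tensor p (a ∷ b ∷ []))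
    wf-par    : ∀ {p a b} → WFCell (gen par p (a ∷ b ∷ []))
    wf-one    : ∀ {p} → WFCell (gen one p [])
    wf-bot    : ∀ {p} → WFCell (gen bot p [])
    wf-oc     : ∀ {p as} → WFCell (gen oc p as)
    wf-wn     : ∀ {p as} → WFCell (gen wn p as)
    wf-box    : ∀ {p ws B} →
                All (λ b → length (concl b) ≡ suc (length ws)) B →
                All WFS B →
                WFCell (box p ws B)

  record WFS (s : SNet) : Set where
    inductive
    field
      wf-cells : All WFCell (cells s)
      wf-wires : ∀ x → x ∈ netNames s → count x (netNames s) ≡ 2

WFNet : ℕ → Net → Set
WFNet n N = All (λ s → length (concl s) ≡ n) N × All WFS N
  where open import Data.Product using (_×_)

-- Rule (e): for each summand b of the content of the box (whose unique
-- conclusion is c0), the content cells are copied, renamed by an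
-- injective ρ sending c0 to the wire q of the dereliction's auxiliary
-- port and all other wires of b to fresh names.

data Expand (L : List Cell) (c : List ℕ) (q : ℕ) : List SNet → Net → Set where
  exp-[] : Expand L c q [] []
  exp-∷  : ∀ {b bs R} (c0 : ℕ) (ρ : ℕ → ℕ) →
           concl b ≡ c0 ∷ [] →
           ρ c0 ≡ q →
           Injective _≡_ _≡_ ρ →
           (∀ x → x ∈ netNames b → x ≢ c0 → ρ x ∉ (c ++ concatMap cellNames L)) →
           Expand L c q bs R →
           Expand L c q (b ∷ bs) (net (L ++ map (ren ρ) (cells b)) c ∷ R)

-- surface (depth 0) steps (e) and (er) on a simple net, producing a net
data _⟶₀_ : SNet → Net → Set where
  rule-e  : ∀ {cs c L p q B R} →
            cs ↭ (gen wn p (q ∷ []) ∷ box p [] B ∷ L) →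
            Expand L c q B R →
            net cs c ⟶₀ R
  rule-er : ∀ {cs c L p B} →
            cs ↭ (gen wn p [] ∷ box p [] B ∷ L) →
            net cs c ⟶₀ (net L c ∷ [])

mutual
  data _⇝ₛ_ : SNet → SNet → Set where
    in-box : ∀ {cs c L p ws B B'} →
             cs ↭ (box p ws B ∷ L) →
             B ⟶ B' →
             net cs c ⇝ₛ net (box p ws B' ∷ L) c

  data _⟶_ : Net → Net → Set where
    surf : ∀ {xs s ys R} → s ⟶₀ R → (xs ++ s ∷ ys) ⟶ (xs ++ R ++ ys)
    deep : ∀ {xs s ys s'} → s ⇝ₛ s' → (xs ++ s ∷ ys) ⟶ (xs ++ s' ∷ ys)

-- the reduction ⇝ : (e)/(er) at depth ≥ 1, in one summand of a net
data _⇝_ : Net → Net → Set where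
  step : ∀ {xs s ys s'} → s ⇝ₛ s' → (xs ++ s ∷ ys) ⇝ (xs ++ s' ∷ ys)

_⇜_ : Net → Net → Set
M ⇜ N = N ⇝ M

module Submission where

-- Say B' ≺ B when B reduces to B' or B' is the content of a box at the surface
-- of a summand of B.  By induction on box nesting, ≺ is well-founded: if all
-- surface box contents of B are ≺-accessible then B is strongly normalising,
-- since a deep step reduces one box content, while a surface (e)/(er) step
-- in a summand replaces one box B₀ by summands whose surface box contents are
-- the other ones plus some subnets of B₀.  So the multiset of surface box
-- contents of a summand decreases in the multiset extension of ≺, and the
-- multiset of summands decreases in the induced multiset extension.  Every
-- reduct of B again has ≺-accessible box contents, hence B is ≺-accessible.

open import Defs
open import Data.Nat using (ℕ)
open import Data.List using (List; []; _∷_; _++_; map; mapMaybe)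
open import Data.List.Properties using (mapMaybe-++)
open import Data.List.Relation.Unary.All as All using (All; []; _∷_; lookup; tabulate)
open import Data.List.Relation.Unary.All.Properties using (++⁺; ++⁻)
open import Data.List.Relation.Unary.Any using (here; there)
open import Data.List.Membership.Propositional using (_∈_)
open import Data.List.Membership.Propositional.Properties using (∈-∃++)
open import Data.List.Relation.Binary.Permutation.Propositional using (_↭_; ↭-refl; ↭-reflexive; ↭-sym; ↭-trans)
open import Data.List.Relation.Binary.Permutation.Propositional.Properties
  using (All-resp-↭; ∈-resp-↭; ¬x∷xs↭[]; drop-∷; drop-mid; shift; shifts; ++⁺ˡ; ++-comm; mapMaybe-↭)
open import Data.Empty using (⊥-elim)
open import Data.Maybe using (Maybe; just; nothing)
open import Data.Product using (Σ-syntax; _×_; _,_)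
open import Data.Sum using (_⊎_; inj₁; inj₂)
open import Function using (_∘_)
open import Induction.WellFounded using (Acc; acc; acc-inverse; WellFounded; module Subrelation)
import Relation.Binary.Construct.On as On
open import Relation.Binary.PropositionalEquality using (_≡_; refl; cong; subst; sym; trans)

-- Finite multisets are lists up to _↭_; N <ₘ M replaces one element a of M by
-- finitely many elements below a.
module MultisetExtension {A : Set} (_<_ : A → A → Set) where

  data _<ₘ_ : List A → List A → Set where
    replace : ∀ {M N a K R} → M ↭ a ∷ K → N ↭ R ++ K → All (_< a) R → N <ₘ M

  Acc-resp-↭ : ∀ {M M'} → M ↭ M' → Acc _<ₘ_ M → Acc _<ₘ_ M'
  Acc-resp-↭ M↭M' (acc rs) = acc λ { (replace M'↭ N↭ R<a) → rs (replace (↭-trans M↭M' M'↭) N↭ R<a) }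

  ∷-↭-∷-inv : ∀ {a b M K} → a ∷ M ↭ b ∷ K →
              (a ≡ b × M ↭ K) ⊎ Σ[ K' ∈ List A ] (M ↭ b ∷ K' × K ↭ a ∷ K')
  ∷-↭-∷-inv {a} {b} p with ∈-resp-↭ (↭-sym p) (here refl)
  ... | here refl = inj₁ (refl , drop-∷ p)
  ... | there b∈M with ∈-∃++ b∈M
  ...   | xs , ys , refl = inj₂ (xs ++ ys , shift b xs ys , ↭-sym (drop-mid (a ∷ xs) [] p))

  -- Outer induction on a, inner induction on M: a step that replaces a itself by
  -- smaller elements falls under the outer hypothesis, any other step under the inner one.
  Acc-∷ : ∀ {a M} → Acc _<_ a → Acc _<ₘ_ M → Acc _<ₘ_ (a ∷ M)
  Acc-∷ {a} (acc smaller) = inner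
    where
    Acc-++ : ∀ {R M} → All (_< a) R → Acc _<ₘ_ M → Acc _<ₘ_ (R ++ M)
    Acc-++ []          accM = accM
    Acc-++ (r<a ∷ R<a) accM = Acc-∷ (smaller r<a) (Acc-++ R<a accM)

    inner : ∀ {M} → Acc _<ₘ_ M → Acc _<ₘ_ (a ∷ M)
    inner {M} (acc below) = acc λ { (replace a∷M↭ N↭ R<b) → accPredecessor a∷M↭ N↭ R<b }
      where
      accPredecessor : ∀ {N b K R} → a ∷ M ↭ b ∷ K → N ↭ R ++ K → All (_< b) R → Acc _<ₘ_ N
      accPredecessor {R = R} a∷M↭ N↭ R<b with ∷-↭-∷-inv a∷M↭
      ... | inj₁ (refl , M↭K) =
        Acc-resp-↭ (↭-sym (↭-trans N↭ (++⁺ˡ R (↭-sym M↭K)))) (Acc-++ R<b (acc below))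
      ... | inj₂ (K' , M↭ , K↭) =
        Acc-resp-↭ (↭-sym (↭-trans N↭ (↭-trans (++⁺ˡ R K↭) (shift a R K'))))
                   (inner (below (replace M↭ ↭-refl R<b)))

  All-Acc⇒Acc : ∀ {M} → All (Acc _<_) M → Acc _<ₘ_ M
  All-Acc⇒Acc []             = acc λ { (replace []↭ _ _) → ⊥-elim (¬x∷xs↭[] (↭-sym []↭)) }
  All-Acc⇒Acc (acc-a ∷ accM) = Acc-∷ acc-a (All-Acc⇒Acc accM)

boxContent : Cell → Maybe Net
boxContent (gen _ _ _) = nothing
boxContent (box _ _ B) = just B

boxContents : List Cell → List Net
boxContents = mapMaybe boxContent

boxContents-++ : ∀ cs ds → boxContents (cs ++ ds) ≡ boxContents cs ++ boxContents ds
boxContents-++ = mapMaybe-++ boxContent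

boxContents-ren : ∀ ρ cs → boxContents (map (ren ρ) cs) ≡ boxContents cs
boxContents-ren ρ [] = refl
boxContents-ren ρ (gen _ _ _ ∷ cs) = boxContents-ren ρ cs
boxContents-ren ρ (box _ _ B ∷ cs) = cong (B ∷_) (boxContents-ren ρ cs)

boxContents-↭ : ∀ {cs ds} → cs ↭ ds → boxContents cs ↭ boxContents ds
boxContents-↭ = mapMaybe-↭ boxContent

Expand-boxContents : ∀ {L c q B R s} → Expand L c q B R → s ∈ R →
                     Σ[ b ∈ SNet ] (b ∈ B × boxContents (cells s) ≡ boxContents L ++ boxContents (cells b))
Expand-boxContents {L} (exp-∷ {b} _ ρ _ _ _ _ _) (here refl) =
  b , here refl , trans (boxContents-++ L _) (cong (boxContents L ++_) (boxContents-ren ρ (cells b)))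
Expand-boxContents (exp-∷ _ _ _ _ _ _ e) (there s∈R) with Expand-boxContents e s∈R
... | b , b∈B , eq = b , there b∈B , eq

data _≺_ (B' B : Net) : Set where
  reduct : B ⟶ B' → B' ≺ B
  subnet : ∀ {b} → b ∈ B → B' ∈ boxContents (cells b) → B' ≺ B

module Contents = MultisetExtension _≺_

data _≺ₛ_ (s' s : SNet) : Set where
  deep-step    : s ⇝ₛ s' → s' ≺ₛ s
  surface-step : ∀ {R} → s ⟶₀ R → s' ∈ R → s' ≺ₛ s

module Summands = MultisetExtension _≺ₛ_

_⟵_ : Net → Net → Set
M ⟵ N = N ⟶ M

SN : Net → Set
SN = Acc _⟵_

BoxesAcc : SNet → Set
BoxesAcc s = All (Acc _≺_) (boxContents (cells s))

≺ₛ⇒boxContents-<ₘ : ∀ {s' s} → s' ≺ₛ s → boxContents (cells s') Contents.<ₘ boxContents (cells s)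
≺ₛ⇒boxContents-<ₘ (deep-step (in-box cs↭ B⟶B')) =
  Contents.replace (boxContents-↭ cs↭) ↭-refl (reduct B⟶B' ∷ [])
≺ₛ⇒boxContents-<ₘ (surface-step (rule-e {L = L} cs↭ e) s'∈R) with Expand-boxContents e s'∈R
... | b , b∈B , eq =
  Contents.replace (boxContents-↭ cs↭)
                   (↭-trans (↭-reflexive eq) (++-comm (boxContents L) (boxContents (cells b))))
                   (tabulate (subnet b∈B))
≺ₛ⇒boxContents-<ₘ (surface-step (rule-er cs↭) (here refl)) =
  Contents.replace (boxContents-↭ cs↭) ↭-refl []

BoxesAcc⇒Acc-≺ₛ : ∀ {s} → BoxesAcc s → Acc _≺ₛ_ s
BoxesAcc⇒Acc-≺ₛ H =
  Subrelation.accessible ≺ₛ⇒boxContents-<ₘ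
    (On.accessible (boxContents ∘ cells) (Contents.All-Acc⇒Acc H))

⟶⇒summands-<ₘ : ∀ {N M} → N ⟶ M → M Summands.<ₘ N
⟶⇒summands-<ₘ (surf {xs} {s} {ys} {R} r) =
  Summands.replace (shift s xs ys) (shifts xs R) (tabulate (surface-step r))
⟶⇒summands-<ₘ (deep {xs} {s} {ys} {s'} st) =
  Summands.replace (shift s xs ys) (shift s' xs ys) (deep-step st ∷ [])

All-BoxesAcc⇒SN : ∀ {N} → All BoxesAcc N → SN N
All-BoxesAcc⇒SN H =
  Subrelation.accessible ⟶⇒summands-<ₘ (Summands.All-Acc⇒Acc (All.map BoxesAcc⇒Acc-≺ₛ H))

⟶₀-preserves-BoxesAcc : ∀ {s R} → s ⟶₀ R → BoxesAcc s → All BoxesAcc R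
⟶₀-preserves-BoxesAcc {R = R} (rule-e cs↭ e) H = tabulate expanded
  where
  expanded : ∀ {s'} → s' ∈ R → BoxesAcc s'
  expanded s'∈R with Expand-boxContents e s'∈R | All-resp-↭ (boxContents-↭ cs↭) H
  ... | b , b∈B , eq | accB ∷ accL =
    subst (All (Acc _≺_)) (sym eq) (++⁺ accL (tabulate λ B'∈b → acc-inverse accB (subnet b∈B B'∈b)))
⟶₀-preserves-BoxesAcc (rule-er cs↭) H with All-resp-↭ (boxContents-↭ cs↭) H
... | _ ∷ accL = accL ∷ []

⇝ₛ-preserves-BoxesAcc : ∀ {s s'} → s ⇝ₛ s' → BoxesAcc s → BoxesAcc s'
⇝ₛ-preserves-BoxesAcc (in-box cs↭ B⟶B') H with All-resp-↭ (boxContents-↭ cs↭) H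
... | accB ∷ accL = acc-inverse accB (reduct B⟶B') ∷ accL

⟶-preserves-BoxesAcc : ∀ {N M} → N ⟶ M → All BoxesAcc N → All BoxesAcc M
⟶-preserves-BoxesAcc (surf {xs} r) H with ++⁻ xs H
... | Hxs , Hs ∷ Hys = ++⁺ Hxs (++⁺ (⟶₀-preserves-BoxesAcc r Hs) Hys)
⟶-preserves-BoxesAcc (deep {xs} st) H with ++⁻ xs H
... | Hxs , Hs ∷ Hys = ++⁺ Hxs (⇝ₛ-preserves-BoxesAcc st Hs ∷ Hys)

SN∧BoxesAcc⇒Acc-≺ : ∀ {N} → SN N → All BoxesAcc N → Acc _≺_ N
SN∧BoxesAcc⇒Acc-≺ (acc reducts) H = acc λ
  { (reduct N⟶M)      → SN∧BoxesAcc⇒Acc-≺ (reducts N⟶M) (⟶-preserves-BoxesAcc N⟶M H)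
  ; (subnet s∈N B∈s) → lookup (lookup H s∈N) B∈s
  }

mutual
  ≺-wellFounded : WellFounded _≺_
  ≺-wellFounded N = SN∧BoxesAcc⇒Acc-≺ (All-BoxesAcc⇒SN H) H
    where H = summands-BoxesAcc N

  summands-BoxesAcc : (N : Net) → All BoxesAcc N
  summands-BoxesAcc []             = []
  summands-BoxesAcc (net cs _ ∷ N) = cells-BoxesAcc cs ∷ summands-BoxesAcc N

  cells-BoxesAcc : (cs : List Cell) → All (Acc _≺_) (boxContents cs)
  cells-BoxesAcc []               = []
  cells-BoxesAcc (gen _ _ _ ∷ cs) = cells-BoxesAcc cs
  cells-BoxesAcc (box _ _ B ∷ cs) = ≺-wellFounded B ∷ cells-BoxesAcc cs

⟶-stronglyNormalising : (N : Net) → SN N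
⟶-stronglyNormalising N = Subrelation.accessible reduct (≺-wellFounded N)

mainTheorem6 : (n : ℕ) (N : Net) → WFNet n N → Acc _⇜_ N
mainTheorem6 _ N _ = Subrelation.accessible (λ { (step st) → deep st }) (⟶-stronglyNormalising N)
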